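{- Let $p,q$ be integers and let $r,s$ be nonzero integers. For all integers $n\ge 0$, $m\ge 1$ and $l\in\{0,1,\dots,m-1\}$, $$H(p,q;r,s;\,mn+l)=H\bigl(H(p,q;r,s;l),\,H(p,q;r,s;m+l);\ SUM(r,s;m),\,-(-s)^m;\ n\bigr),$$ where $$SUM(r,s;m)=r^m\sum_{k=0}^{\lfloor m/2\rfloor}T(m,k)\,\left(\frac{s}{r^2}\right)^k .$$
   Context: For given $p,q,r,s$, the (Horadam) sequence $H(p,q;r,s;n)$, $n\ge 0$, is defined by $H(p,q;r,s;0)=p$, $H(p,q;r,s;1)=q$ and $H(p,q;r,s;n)=r\,H(p,q;r,s;n-1)+s\,H(p,q;r,s;n-2)$ for $n\ge 2$; $(p,q)$ are called the seeds and $(r,s)$ the signature. $T(n,k)$ is the irregular triangle OEIS A034807: $T(0,0)=2$ and $T(n,k)=\frac{n\,(n-1-k)!}{k!\,(n-2k)!}$ for $n\ge 1$ and $0\le k\le\lfloor n/2\rfloor$. -}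

module Defs where

open import Data.Nat.Base as ℕ using (ℕ; zero; suc; _∸_; _!; ⌊_/2⌋)
open import Data.Nat.Properties using (_!*_!≢0)
open import Data.Fin.Base using (Fin; toℕ)
open import Data.Integer.Base as ℤ using (ℤ; +_)
open import Data.Integer.GCD using (gcd)
open import Data.Rational.Base
  using (ℚ; ↥_; _/_; _+_; _*_; _÷_; NonZero; ≢-nonZero; +-*-rawSemiring)
import Data.Rational.Properties as ℚ
open import Relation.Binary.PropositionalEquality using (cong; sym; trans)

open import Algebra.Definitions.RawSemiring +-*-rawSemiring public
  using (_^_; sum)

fromℤ : ℤ → ℚ
fromℤ i = i / 1

H : (p q r s : ℚ) → ℕ → ℚ
H p q r s zero          = p
H p q r s (suc zero)    = q
H p q r s (suc (suc n)) = r * H p q r s (suc n) + s * H p q r s n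

-- Row n has the entries k = 0, …, ⌊ n /2⌋, so neither ∸ truncates for n ≥ 1.
-- The quotient is taken in ℚ because SUM is rational as written.
T : (n : ℕ) → Fin (suc ⌊ n /2⌋) → ℚ
T zero      _ = + 2 / 1
T n@(suc _) k =
  _/_ (+ (n ℕ.* (n ∸ 1 ∸ toℕ k) !))
      (toℕ k ! ℕ.* (n ∸ 2 ℕ.* toℕ k) !)
      {{toℕ k !* (n ∸ 2 ℕ.* toℕ k) !≢0}}

fromℤ-nonZero : ∀ i → .{{ℤ.NonZero i}} → NonZero (fromℤ i)
fromℤ-nonZero i = ≢-nonZero {fromℤ i} λ i/1≡0 →
  ℕ.≢-nonZero⁻¹ ℤ.∣ i ∣ (cong ℤ.∣_∣
    (trans (sym (ℚ.↥-/ i 1)) (cong (λ x → ↥ x ℤ.* gcd i (+ 1)) i/1≡0)))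

square-nonZero : ∀ r → .{{ℤ.NonZero r}} → ℤ.NonZero (r ℤ.^ 2)
square-nonZero ℤ.+[1+ n ]  = _
square-nonZero ℤ.-[1+ n ] = _

SUM : (r s : ℤ) → .{{ℤ.NonZero r}} → ℕ → ℚ
SUM r s m = fromℤ r ^ m * sum (λ k → T m k * s/r² ^ toℕ k)
  where
  instance
    r²≢0 : NonZero (fromℤ (r ℤ.^ 2))
    r²≢0 = fromℤ-nonZero (r ℤ.^ 2) {{square-nonZero r}}
  s/r² : ℚ
  s/r² = fromℤ s ÷ fromℤ (r ℤ.^ 2)

{-# OPTIONS --safe #-}

-- With x = s/r², the row polynomials of T satisfy Wₙ₊₂ = Wₙ₊₁ + x Wₙ, so
-- SUM(r,s;m) = rᵐ Wₘ is the Lucas sequence V = H(2,r;r,s). Every sequence a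
-- with signature (r,s) satisfies a(k+2m) + (−s)ᵐ a(k) = Vₘ a(k+m) (induction
-- on m); hence n ↦ a(mn+l) is a Horadam sequence with signature (Vₘ, −(−s)ᵐ).

module Submission where

open import Defs
open import Algebra.Bundles using (module CommutativeRing)
import Algebra.Properties.CommutativeMonoid.Sum as CommutativeMonoidSum
import Algebra.Properties.Semiring.Sum as SemiringSum
open import Data.Fin.Base using (Fin; toℕ)
open import Data.Fin.Properties using (toℕ≤pred[n])
open import Data.Integer.Base as ℤ using (ℤ; +_)
import Data.Integer.Properties as ℤ
open import Data.Nat.Base as ℕ using (ℕ; zero; suc; _∸_; _!; ⌊_/2⌋; z≤n; s≤s)
import Data.Nat.Properties as ℕ
open import Data.Nat.Tactic.RingSolver using (solve-∀)
open import Data.Rational.Base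
  using (ℚ; 0ℚ; 1ℚ; _/_; _+_; _*_; -_; 1/_; _÷_; NonZero; toℚᵘ)
import Data.Rational.Properties as ℚ
open import Data.Rational.Solver using (module +-*-Solver)
open import Data.Rational.Unnormalised.Base as ℚᵘ using (mkℚᵘ; *≡*)
import Data.Rational.Unnormalised.Properties as ℚᵘ
open import Relation.Binary.PropositionalEquality
  using (_≡_; refl; sym; trans; cong; cong₂; module ≡-Reasoning)

open +-*-Solver using (solve; _:+_; _:*_; :-_; _:=_; con)
open CommutativeMonoidSum ℚ.+-0-commutativeMonoid
  using (∑-distrib-+; sum-cong-≗; sum-replicate-zero)
open SemiringSum (CommutativeRing.semiring ℚ.+-*-commutativeRing)
  using (*-distribˡ-sum)
open ≡-Reasoning

-- Integers and exact quotients inside ℚ.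

2ℚ : ℚ
2ℚ = + 2 / 1

fromℕ : ℕ → ℚ
fromℕ n = fromℤ (+ n)

-- The quotient `i / 1` is normalised through a gcd and does not compute for a variable `i`;
-- unnormalised fractions bypass this.
toℚᵘ-fromℤ : ∀ i → toℚᵘ (fromℤ i) ℚᵘ.≃ mkℚᵘ i 0
toℚᵘ-fromℤ i = ℚ.toℚᵘ-fromℚᵘ (mkℚᵘ i 0)

fromℤ-+ : ∀ i j → fromℤ (i ℤ.+ j) ≡ fromℤ i + fromℤ j
fromℤ-+ i j = ℚ.toℚᵘ-injective (≤-begin
  toℚᵘ (fromℤ (i ℤ.+ j))               ≃⟨ toℚᵘ-fromℤ (i ℤ.+ j) ⟩
  mkℚᵘ (i ℤ.+ j) 0                     ≃⟨ *≡* (cong (ℤ._* + 1) (sym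
                                            (cong₂ ℤ._+_ (ℤ.*-identityʳ i) (ℤ.*-identityʳ j)))) ⟩
  mkℚᵘ i 0 ℚᵘ.+ mkℚᵘ j 0               ≃⟨ ℚᵘ.+-cong (toℚᵘ-fromℤ i) (toℚᵘ-fromℤ j) ⟨
  toℚᵘ (fromℤ i) ℚᵘ.+ toℚᵘ (fromℤ j)   ≃⟨ ℚ.toℚᵘ-homo-+ (fromℤ i) (fromℤ j) ⟨
  toℚᵘ (fromℤ i + fromℤ j)             ≤-∎)
  where open ℚᵘ.≤-Reasoning renaming (begin-equality_ to ≤-begin_; _∎ to _≤-∎)

fromℤ-* : ∀ i j → fromℤ (i ℤ.* j) ≡ fromℤ i * fromℤ j
fromℤ-* i j = ℚ.toℚᵘ-injective (≤-begin
  toℚᵘ (fromℤ (i ℤ.* j))               ≃⟨ toℚᵘ-fromℤ (i ℤ.* j) ⟩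
  mkℚᵘ i 0 ℚᵘ.* mkℚᵘ j 0               ≃⟨ ℚᵘ.*-cong (toℚᵘ-fromℤ i) (toℚᵘ-fromℤ j) ⟨
  toℚᵘ (fromℤ i) ℚᵘ.* toℚᵘ (fromℤ j)   ≃⟨ ℚ.toℚᵘ-homo-* (fromℤ i) (fromℤ j) ⟨
  toℚᵘ (fromℤ i * fromℤ j)             ≤-∎)
  where open ℚᵘ.≤-Reasoning renaming (begin-equality_ to ≤-begin_; _∎ to _≤-∎)

-- Cross-multiplication, which turns the factorial quotient in `T` into an identity of natural
-- numbers.
/-exact : ∀ a b c .{{_ : ℕ.NonZero b}} → c ℕ.* b ≡ a → + a / b ≡ fromℕ c
/-exact a b@(suc _) c c*b≡a = ℚ.fromℚᵘ-cong {mkℚᵘ (+ a) _} {mkℚᵘ (+ c) 0} (*≡* (begin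
  + a ℤ.* + 1     ≡⟨ ℤ.*-identityʳ (+ a) ⟩
  + a             ≡⟨ cong +_ c*b≡a ⟨
  + (c ℕ.* b)     ≡⟨ ℤ.pos-* c b ⟩
  + c ℤ.* + b     ∎))

-- The triangle T

-- A034807 through its Pascal-like recurrence, continued by zeros to every column; the corner 2 is
-- the only irregular value in column 0.
triangle : ℕ → ℕ → ℕ
triangle zero          zero    = 2
triangle zero          (suc k) = 0
triangle (suc n)       zero    = 1
triangle (suc zero)    (suc k) = 0
triangle (suc (suc n)) (suc k) = triangle (suc n) (suc k) ℕ.+ triangle n k

triangle-right : ∀ n k → n ℕ.< k ℕ.* 2 → triangle n k ≡ 0
triangle-right zero          (suc k) n<2k             = refl
triangle-right (suc zero)    (suc k) n<2k             = refl
triangle-right (suc (suc n)) (suc k) (s≤s (s≤s n<2k)) = cong₂ ℕ._+_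
  (triangle-right (suc n) (suc k) (s≤s (ℕ.m≤n⇒m≤1+n n<2k)))
  (triangle-right n k n<2k)

-- The other summand always lies beyond the end of its row, so the corner 2 travels down the
-- diagonal unchanged.
triangle-middle : ∀ k → triangle (k ℕ.* 2) k ≡ 2
triangle-middle zero    = refl
triangle-middle (suc k) = cong₂ ℕ._+_
  (triangle-right (suc (k ℕ.* 2)) (suc k) ℕ.≤-refl) (triangle-middle k)

mutual
  -- The factorial formula with denominators cleared, at column k + 1 of row n = 2(k + 1) + j, so
  -- that no subtraction occurs. Of the two summands of an entry, one lowers `j` and the other
  -- lowers the column.
  triangle-! : ∀ k j → triangle (suc k ℕ.* 2 ℕ.+ j) (suc k) ℕ.* (suc k ! ℕ.* j !)
                     ≡ (suc k ℕ.* 2 ℕ.+ j) ℕ.* (k ℕ.+ j) !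
  triangle-! k zero
    rewrite ℕ.+-identityʳ (k ℕ.* 2) | ℕ.+-identityʳ k | triangle-middle (suc k)
    = regroup k (k !)
    where
    regroup : ∀ k f → 2 ℕ.* ((suc k ℕ.* f) ℕ.* 1) ≡ suc k ℕ.* 2 ℕ.* f
    regroup = solve-∀
  triangle-! k (suc j) = begin
    (A ℕ.+ B) ℕ.* (suc k ! ℕ.* suc j !)
      -- Each summand needs one factor to complete its own factorials: j + 1 for `A`, k + 1 for `B`.
      ≡⟨ split A B k j (k !) (j !) ⟩
    suc j ℕ.* (A ℕ.* (suc k ! ℕ.* j !)) ℕ.+ suc k ℕ.* (B ℕ.* (k ! ℕ.* suc j !))
      ≡⟨ cong₂ (λ u v → suc j ℕ.* u ℕ.+ suc k ℕ.* v) A-! (triangle-!′ k j) ⟩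
    suc j ℕ.* ((suc k ℕ.* 2 ℕ.+ j) ℕ.* (k ℕ.+ j) !)
      ℕ.+ suc k ℕ.* ((k ℕ.* 2 ℕ.+ suc j) ℕ.* (k ℕ.+ j) !)
      ≡⟨ merge k j ((k ℕ.+ j) !) ⟩
    (suc k ℕ.* 2 ℕ.+ suc j) ℕ.* (suc (k ℕ.+ j)) !
      ≡⟨ cong (λ i → (suc k ℕ.* 2 ℕ.+ suc j) ℕ.* i !) (ℕ.+-suc k j) ⟨
    (suc k ℕ.* 2 ℕ.+ suc j) ℕ.* (k ℕ.+ suc j) ! ∎
    where
    A = triangle (suc (k ℕ.* 2 ℕ.+ suc j)) (suc k)
    B = triangle (k ℕ.* 2 ℕ.+ suc j) k
    A-! : A ℕ.* (suc k ! ℕ.* j !) ≡ (suc k ℕ.* 2 ℕ.+ j) ℕ.* (k ℕ.+ j) !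
    A-! = trans
      (cong (λ i → triangle (suc i) (suc k) ℕ.* (suc k ! ℕ.* j !)) (ℕ.+-suc (k ℕ.* 2) j))
      (triangle-! k j)
    split : ∀ A B k j f g →
      (A ℕ.+ B) ℕ.* ((suc k ℕ.* f) ℕ.* (suc j ℕ.* g))
      ≡ suc j ℕ.* (A ℕ.* ((suc k ℕ.* f) ℕ.* g)) ℕ.+ suc k ℕ.* (B ℕ.* (f ℕ.* (suc j ℕ.* g)))
    split = solve-∀
    merge : ∀ k j f →
      suc j ℕ.* ((suc k ℕ.* 2 ℕ.+ j) ℕ.* f) ℕ.+ suc k ℕ.* ((k ℕ.* 2 ℕ.+ suc j) ℕ.* f)
      ≡ (suc k ℕ.* 2 ℕ.+ suc j) ℕ.* (suc (k ℕ.+ j) ℕ.* f)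
    merge = solve-∀

  triangle-!′ : ∀ k j → triangle (k ℕ.* 2 ℕ.+ suc j) k ℕ.* (k ! ℕ.* suc j !)
                      ≡ (k ℕ.* 2 ℕ.+ suc j) ℕ.* (k ℕ.+ j) !
  triangle-!′ zero    j = trans (ℕ.*-identityˡ _) (ℕ.*-identityˡ _)
  triangle-!′ (suc k) j = trans (triangle-! k (suc j))
    (cong (λ i → (suc k ℕ.* 2 ℕ.+ suc j) ℕ.* i !) (ℕ.+-suc k j))

-- The witness `j` encodes 2k ≤ n + 1, which makes both truncated subtractions exact.
triangle-closed : ∀ n k j → k ℕ.* 2 ℕ.+ j ≡ suc n →
  triangle (suc n) k ℕ.* (k ! ℕ.* (suc n ∸ 2 ℕ.* k) !) ≡ suc n ℕ.* (n ∸ k) !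
triangle-closed n zero    j refl = trans (ℕ.*-identityˡ _) (ℕ.*-identityˡ _)
triangle-closed n (suc k) j refl = begin
  triangle (suc n) (suc k) ℕ.* (suc k ! ℕ.* (suc n ∸ 2 ℕ.* suc k) !)
    ≡⟨ cong (λ i → triangle (suc n) (suc k) ℕ.* (suc k ! ℕ.* i !)) n∸2k ⟩
  triangle (suc n) (suc k) ℕ.* (suc k ! ℕ.* j !)
    ≡⟨ triangle-! k j ⟩
  suc n ℕ.* (k ℕ.+ j) !
    ≡⟨ cong (λ i → suc n ℕ.* i !) n∸k ⟨
  suc n ℕ.* (n ∸ suc k) ! ∎
  where
  n∸2k : suc n ∸ 2 ℕ.* suc k ≡ j
  n∸2k = trans (cong (suc n ∸_) (ℕ.*-comm 2 (suc k))) (ℕ.m+n∸m≡n (suc k ℕ.* 2) j)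
  double : ∀ k j → k ℕ.* 2 ℕ.+ j ≡ k ℕ.+ (k ℕ.+ j)
  double = solve-∀
  n∸k : n ∸ suc k ≡ k ℕ.+ j
  n∸k = trans (cong (_∸ k) (double k j)) (ℕ.m+n∸m≡n k (k ℕ.+ j))

⌊n/2⌋*2≤n : ∀ n → ⌊ n /2⌋ ℕ.* 2 ℕ.≤ n
⌊n/2⌋*2≤n zero          = z≤n
⌊n/2⌋*2≤n (suc zero)    = z≤n
⌊n/2⌋*2≤n (suc (suc n)) = s≤s (s≤s (⌊n/2⌋*2≤n n))

n<1+⌊n/2⌋*2 : ∀ n → n ℕ.< suc ⌊ n /2⌋ ℕ.* 2
n<1+⌊n/2⌋*2 zero          = s≤s z≤n
n<1+⌊n/2⌋*2 (suc zero)    = s≤s (s≤s z≤n)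
n<1+⌊n/2⌋*2 (suc (suc n)) = s≤s (s≤s (n<1+⌊n/2⌋*2 n))

T≡triangle : ∀ n (k : Fin (suc ⌊ n /2⌋)) → T n k ≡ fromℕ (triangle n (toℕ k))
T≡triangle zero      Fin.zero = refl
T≡triangle n@(suc n-1) k =
  /-exact _ _ (triangle n (toℕ k)) {{toℕ k ℕ.!* (n ∸ 2 ℕ.* toℕ k) !≢0}}
    (triangle-closed n-1 (toℕ k) (n ∸ toℕ k ℕ.* 2) (ℕ.m+[n∸m]≡n 2k≤n))
  where
  2k≤n : toℕ k ℕ.* 2 ℕ.≤ n
  2k≤n = ℕ.≤-trans (ℕ.*-monoˡ-≤ 2 (toℕ≤pred[n] k)) (⌊n/2⌋*2≤n n)

-- Row polynomials

row : ℚ → ℕ → ℕ → ℚ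
row x N n = sum {N} λ k → fromℕ (triangle n (toℕ k)) * x ^ toℕ k

-- The recurrence of `triangle` splits every term but the first. In the second part the column index
-- drops by one, which releases a factor `x` and shortens the sum from N + 1 to `N` terms.
row-rec : ∀ x N n → row x (suc N) (suc (suc n)) ≡ row x (suc N) (suc n) + x * row x N n
row-rec x N n = begin
  c + sum {N} (λ k → fromℕ (a k ℕ.+ b k) * x ^ suc (toℕ k))
    ≡⟨ cong (λ u → c + u) (sum-cong-≗ term) ⟩
  c + sum {N} (λ k → fromℕ (a k) * x ^ suc (toℕ k) + x * (fromℕ (b k) * x ^ toℕ k))
    ≡⟨ cong (λ u → c + u) (∑-distrib-+ {N} _ _) ⟩
  c + (ΣA + ΣB)
    ≡⟨ ℚ.+-assoc c ΣA ΣB ⟨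
  row x (suc N) (suc n) + ΣB
    ≡⟨ cong (λ u → row x (suc N) (suc n) + u) (*-distribˡ-sum {N} x _) ⟨
  row x (suc N) (suc n) + x * row x N n ∎
  where
  -- The term of column 0, common to rows n + 1 and n + 2, in the form to which it reduces.
  c = 1ℚ * 1ℚ
  a b : Fin N → ℕ
  a k = triangle (suc n) (suc (toℕ k))
  b k = triangle n (toℕ k)
  ΣA = sum {N} (λ k → fromℕ (a k) * x ^ suc (toℕ k))
  ΣB = sum {N} (λ k → x * (fromℕ (b k) * x ^ toℕ k))
  term : ∀ k → fromℕ (a k ℕ.+ b k) * x ^ suc (toℕ k)
             ≡ fromℕ (a k) * x ^ suc (toℕ k) + x * (fromℕ (b k) * x ^ toℕ k)
  term k = trans (cong (_* x ^ suc (toℕ k)) (fromℤ-+ (+ a k) (+ b k)))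
    (solve 4 (λ a b x y → (a :+ b) :* (x :* y) := a :* (x :* y) :+ x :* (b :* y)) refl
      (fromℕ (a k)) (fromℕ (b k)) x (x ^ toℕ k))

sum-0* : ∀ N (f : Fin N → ℚ) → sum (λ k → 0ℚ * f k) ≡ 0ℚ
sum-0* N f = trans (sum-cong-≗ (λ k → ℚ.*-zeroˡ (f k))) (sum-replicate-zero N)

-- Any cut-off N > n/2 gives the same value; keeping N free is what lets the
-- induction pass between rows of different lengths.
lucas-row : ∀ r s x → x * (r * r) ≡ s → ∀ n N → n ℕ.< N ℕ.* 2 →
  r ^ n * row x N n ≡ H 2ℚ r r s n
lucas-row r s x xr²≡s zero (suc N) n<2N = begin
  1ℚ * (2ℚ * 1ℚ + sum {N} (λ k → 0ℚ * x ^ suc (toℕ k)))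
    ≡⟨ cong (λ u → 1ℚ * (2ℚ * 1ℚ + u)) (sum-0* N (λ k → x ^ suc (toℕ k))) ⟩
  2ℚ ∎
lucas-row r s x xr²≡s (suc zero) (suc N) n<2N = begin
  r * 1ℚ * (1ℚ * 1ℚ + sum {N} (λ k → 0ℚ * x ^ suc (toℕ k)))
    ≡⟨ cong (λ u → r * 1ℚ * (1ℚ * 1ℚ + u)) (sum-0* N (λ k → x ^ suc (toℕ k))) ⟩
  r * 1ℚ * 1ℚ
    ≡⟨ trans (ℚ.*-identityʳ (r * 1ℚ)) (ℚ.*-identityʳ r) ⟩
  r ∎
lucas-row r s x xr²≡s (suc (suc n)) (suc N) (s≤s (s≤s n<2N)) = begin
  r ^ suc (suc n) * row x (suc N) (suc (suc n))
    ≡⟨ cong (λ u → r ^ suc (suc n) * u) (row-rec x N n) ⟩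
  r * (r * r ^ n) * (row x (suc N) (suc n) + x * row x N n)
    -- The two extra factors `r` join `x`, so that x r² can become `s`.
    ≡⟨ solve 5 (λ r p u x v → r :* (r :* p) :* (u :+ x :* v)
                            := r :* (r :* p :* u) :+ x :* (r :* r) :* (p :* v))
         refl r (r ^ n) (row x (suc N) (suc n)) x (row x N n) ⟩
  r * (r ^ suc n * row x (suc N) (suc n)) + x * (r * r) * (r ^ n * row x N n)
    ≡⟨ cong₂ (λ u v → r * u + x * (r * r) * v)
         (lucas-row r s x xr²≡s (suc n) (suc N) (s≤s (ℕ.m≤n⇒m≤1+n n<2N)))
         (lucas-row r s x xr²≡s n N n<2N) ⟩
  r * H 2ℚ r r s (suc n) + x * (r * r) * H 2ℚ r r s n
    ≡⟨ cong (λ u → r * H 2ℚ r r s (suc n) + u * H 2ℚ r r s n) xr²≡s ⟩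
  H 2ℚ r r s (suc (suc n)) ∎

SUM-lucas : ∀ r s .{{_ : ℤ.NonZero r}} m →
  SUM r s m ≡ H 2ℚ (fromℤ r) (fromℤ r) (fromℤ s) m
SUM-lucas r s m = trans
  (cong (λ u → fromℤ r ^ m * u)
    (sum-cong-≗ (λ k → cong (λ u → u * x ^ toℕ k) (T≡triangle m k))))
  (lucas-row (fromℤ r) (fromℤ s) x xr²≡s m (suc ⌊ m /2⌋) (n<1+⌊n/2⌋*2 m))
  where
  R = fromℤ (r ℤ.^ 2)
  -- Nonzeroness is an irrelevant argument of `÷`, so the `x` below agrees definitionally with the
  -- quotient inside `SUM`.
  instance
    R≢0 : NonZero R
    R≢0 = fromℤ-nonZero (r ℤ.^ 2) {{square-nonZero r}}
  x = fromℤ s ÷ R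
  r*r≡R : fromℤ r * fromℤ r ≡ R
  r*r≡R = trans (sym (fromℤ-* r r)) (cong (λ i → fromℤ (r ℤ.* i)) (sym (ℤ.*-identityʳ r)))
  xr²≡s : x * (fromℤ r * fromℤ r) ≡ fromℤ s
  xr²≡s = begin
    fromℤ s * 1/ R * (fromℤ r * fromℤ r) ≡⟨ cong (λ u → fromℤ s * 1/ R * u) r*r≡R ⟩
    fromℤ s * 1/ R * R                   ≡⟨ ℚ.*-assoc (fromℤ s) (1/ R) R ⟩
    fromℤ s * (1/ R * R)                 ≡⟨ cong (λ u → fromℤ s * u) (ℚ.*-inverseˡ R) ⟩
    fromℤ s * 1ℚ                         ≡⟨ ℚ.*-identityʳ (fromℤ s) ⟩
    fromℤ s                              ∎

-- Horadam sequences

Recurrent : (r s : ℚ) → (ℕ → ℚ) → Set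
Recurrent r s a = ∀ n → a (suc (suc n)) ≡ r * a (suc n) + s * a n

recurrent-unique : ∀ r s a → Recurrent r s a → ∀ n → a n ≡ H (a 0) (a 1) r s n
recurrent-unique r s a rec zero          = refl
recurrent-unique r s a rec (suc zero)    = refl
recurrent-unique r s a rec (suc (suc n)) = trans (rec n)
  (cong₂ (λ u v → r * u + s * v)
    (recurrent-unique r s a rec (suc n)) (recurrent-unique r s a rec n))

-- If α, β are the roots of t² = rt + s, then `H 2ℚ r r s m` is αᵐ + βᵐ and αβ = -s, which explains
-- the identity. The induction avoids roots; it uses m + 1 at k + 1 and `m` at k + 2, so that both
-- right-hand sides contain a(m + k + 2).
recurrent-double : ∀ r s a → Recurrent r s a → ∀ m k →
  a (m ℕ.* 2 ℕ.+ k) + (- s) ^ m * a k ≡ H 2ℚ r r s m * a (m ℕ.+ k)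
recurrent-double r s a rec zero k =
  solve 1 (λ u → u :+ con 1ℚ :* u := con 2ℚ :* u) refl (a k)
recurrent-double r s a rec (suc zero) k = trans
  (cong (λ u → u + - s * 1ℚ * a k) (rec k))
  (solve 4 (λ r s u v → (r :* u :+ s :* v) :+ (:- s) :* con 1ℚ :* v := r :* u) refl
    r s (a (suc k)) (a k))
recurrent-double r s a rec (suc (suc m)) k = begin
  a (4 ℕ.+ i) + - s * (- s * P) * a k
    ≡⟨ cong (λ u → u + - s * (- s * P) * a k) (rec (2 ℕ.+ i)) ⟩
  r * a (3 ℕ.+ i) + s * a (2 ℕ.+ i) + - s * (- s * P) * a k
    -- The terms in `z`, that is a(k + 1), cancel; they are inserted to form the left-hand sides of
    -- both induction hypotheses.
    ≡⟨ solve 7 (λ r s P u v w z →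
         r :* u :+ s :* v :+ (:- s) :* ((:- s) :* P) :* w
         := r :* (u :+ (:- s) :* P :* z) :+ s :* (v :+ P :* (r :* z :+ s :* w)))
         refl r s P (a (3 ℕ.+ i)) (a (2 ℕ.+ i)) (a k) (a (1 ℕ.+ k)) ⟩
  r * (a (3 ℕ.+ i) + - s * P * a (1 ℕ.+ k))
    + s * (a (2 ℕ.+ i) + P * (r * a (1 ℕ.+ k) + s * a k))
    ≡⟨ cong (λ u → r * (a (3 ℕ.+ i) + - s * P * a (1 ℕ.+ k)) + s * (a (2 ℕ.+ i) + P * u)) (rec k) ⟨
  r * (a (3 ℕ.+ i) + - s * P * a (1 ℕ.+ k)) + s * (a (2 ℕ.+ i) + P * a (2 ℕ.+ k))
    ≡⟨ cong₂ (λ u v → r * u + s * v)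
         (step₁ (recurrent-double r s a rec (suc m) (1 ℕ.+ k)))
         (step₀ (recurrent-double r s a rec m (2 ℕ.+ k))) ⟩
  r * (V₁ * a (2 ℕ.+ m ℕ.+ k)) + s * (V₀ * a (2 ℕ.+ m ℕ.+ k))
    ≡⟨ solve 5 (λ r s u v w → r :* (u :* w) :+ s :* (v :* w) := (r :* u :+ s :* v) :* w)
         refl r s V₁ V₀ (a (2 ℕ.+ m ℕ.+ k)) ⟩
  (r * V₁ + s * V₀) * a (2 ℕ.+ m ℕ.+ k) ∎
  where
  i  = m ℕ.* 2 ℕ.+ k
  P  = (- s) ^ m
  V₀ = H 2ℚ r r s m
  V₁ = H 2ℚ r r s (suc m)
  shift : ∀ n k → n ℕ.+ (2 ℕ.+ k) ≡ 2 ℕ.+ (n ℕ.+ k)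
  shift = solve-∀
  step₁ : a (suc m ℕ.* 2 ℕ.+ (1 ℕ.+ k)) + - s * P * a (1 ℕ.+ k) ≡ V₁ * a (suc m ℕ.+ (1 ℕ.+ k)) →
          a (3 ℕ.+ i) + - s * P * a (1 ℕ.+ k) ≡ V₁ * a (2 ℕ.+ m ℕ.+ k)
  step₁ ih = begin
    a (3 ℕ.+ i) + - s * P * a (1 ℕ.+ k)
      ≡⟨ cong (λ j → a (2 ℕ.+ j) + - s * P * a (1 ℕ.+ k)) (ℕ.+-suc (m ℕ.* 2) k) ⟨
    a (suc m ℕ.* 2 ℕ.+ suc k) + (- s) ^ suc m * a (suc k)
      ≡⟨ ih ⟩
    V₁ * a (suc (m ℕ.+ suc k))
      ≡⟨ cong (λ j → V₁ * a (suc j)) (ℕ.+-suc m k) ⟩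
    V₁ * a (2 ℕ.+ m ℕ.+ k) ∎
  step₀ : a (m ℕ.* 2 ℕ.+ (2 ℕ.+ k)) + P * a (2 ℕ.+ k) ≡ V₀ * a (m ℕ.+ (2 ℕ.+ k)) →
          a (2 ℕ.+ i) + P * a (2 ℕ.+ k) ≡ V₀ * a (2 ℕ.+ m ℕ.+ k)
  step₀ ih = begin
    a (2 ℕ.+ i) + P * a (2 ℕ.+ k)
      ≡⟨ cong (λ j → a j + P * a (2 ℕ.+ k)) (shift (m ℕ.* 2) k) ⟨
    a (m ℕ.* 2 ℕ.+ (2 ℕ.+ k)) + P * a (2 ℕ.+ k)
      ≡⟨ ih ⟩
    V₀ * a (m ℕ.+ (2 ℕ.+ k))
      ≡⟨ cong (λ j → V₀ * a j) (shift m k) ⟩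
    V₀ * a (2 ℕ.+ m ℕ.+ k) ∎

-- The doubling identity at k = mn + l, solved for its leading term: k, k + m and k + 2m are three
-- consecutive indices of the subsequence.
recurrent-multisection : ∀ r s a → Recurrent r s a → ∀ m l →
  Recurrent (H 2ℚ r r s m) (- ((- s) ^ m)) (λ n → a (m ℕ.* n ℕ.+ l))
recurrent-multisection r s a rec m l n = begin
  a (m ℕ.* suc (suc n) ℕ.+ l)
    ≡⟨ cong a (index₂ m n l) ⟩
  a (m ℕ.* 2 ℕ.+ k)
    ≡⟨ solve 2 (λ u w → u := (u :+ w) :+ :- w) refl (a (m ℕ.* 2 ℕ.+ k)) (P * a k) ⟩
  (a (m ℕ.* 2 ℕ.+ k) + P * a k) + - (P * a k)
    ≡⟨ cong₂ _+_ (recurrent-double r s a rec m k) (ℚ.neg-distribˡ-* P (a k)) ⟩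
  V * a (m ℕ.+ k) + - P * a k
    ≡⟨ cong (λ i → V * a i + - P * a k) (index₁ m n l) ⟨
  V * a (m ℕ.* suc n ℕ.+ l) + - P * a k ∎
  where
  k = m ℕ.* n ℕ.+ l
  P = (- s) ^ m
  V = H 2ℚ r r s m
  index₁ : ∀ m n l → m ℕ.* suc n ℕ.+ l ≡ m ℕ.+ (m ℕ.* n ℕ.+ l)
  index₁ = solve-∀
  index₂ : ∀ m n l → m ℕ.* suc (suc n) ℕ.+ l ≡ m ℕ.* 2 ℕ.+ (m ℕ.* n ℕ.+ l)
  index₂ = solve-∀

mainTheorem2 : (p q r s : ℤ) → .{{_ : ℤ.NonZero r}} → .{{_ : ℤ.NonZero s}} →
    (n m l : ℕ) → 1 ℕ.≤ m → l ℕ.< m →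
    let Hₚ = H (fromℤ p) (fromℤ q) (fromℤ r) (fromℤ s) in
    Hₚ (m ℕ.* n ℕ.+ l)
    ≡ H (Hₚ l) (Hₚ (m ℕ.+ l)) (SUM r s m) (- ((- fromℤ s) ^ m)) n
mainTheorem2 p q r s n m l _ _ = begin
  a (m ℕ.* n ℕ.+ l)
    -- The recurrence for `a` is the last clause of `H`, hence `refl`; the seeds are read off at n =
    -- 0 and n = 1.
    ≡⟨ recurrent-unique V Q (λ n → a (m ℕ.* n ℕ.+ l))
         (recurrent-multisection (fromℤ r) (fromℤ s) a (λ _ → refl) m l) n ⟩
  H (a (m ℕ.* 0 ℕ.+ l)) (a (m ℕ.* 1 ℕ.+ l)) V Q n
    ≡⟨ cong₂ (λ i j → H (a (i ℕ.+ l)) (a (j ℕ.+ l)) V Q n) (ℕ.*-zeroʳ m) (ℕ.*-identityʳ m) ⟩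
  H (a l) (a (m ℕ.+ l)) V Q n
    ≡⟨ cong (λ u → H (a l) (a (m ℕ.+ l)) u Q n) (SUM-lucas r s m) ⟨
  H (a l) (a (m ℕ.+ l)) (SUM r s m) Q n ∎
  where
  a = H (fromℤ p) (fromℤ q) (fromℤ r) (fromℤ s)
  V = H 2ℚ (fromℤ r) (fromℤ r) (fromℤ s) m
  Q = - ((- fromℤ s) ^ m)
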